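{- Let $G$ be a word-representable graph and let $v$ be a vertex of $G$. Then there exists a semi-transitive orientation of $G$ in which $v$ is a source. Likewise, there exists a semi-transitive orientation of $G$ in which $v$ is a sink.
   Context: Graphs are finite, simple and undirected. Two distinct letters $x$ and $y$ alternate in a word $w$ if after deleting from $w$ all letters except the copies of $x$ and $y$ one obtains either a word $xyxy\cdots$ (of even or odd length) or a word $yxyx\cdots$ (of even or odd length). A graph $G=(V,E)$ is word-representable if there exists a (finite) word $w$ over the alphabet $V$, in which each letter of $V$ occurs at least once, such that for all distinct $x,y\in V$, the letters $x$ and $y$ alternate in $w$ if and only if $xy\in E$. An orientation of a graph assigns a direction to each edge. An orientation is semi-transitive if it is acyclic (contains no directed cycles) and for any directed path $v_0\rightarrow v_1\rightarrow\cdots\rightarrow v_k$ either there is no edge between $v_0$ and $v_k$, or $v_i\rightarrow v_j$ is an edge for all $0\le i<j\le k$. A vertex is a source in an orientation if all edges incident with it are oriented away from it, and a sink if all edges incident with it are oriented towards it. -}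

module Defs where

open import Data.Fin using (Fin; zero; suc; inject₁; fromℕ; _<_)
open import Data.Fin.Properties using (_≟_)
open import Data.List using (List; []; _∷_; filter)
open import Data.List.Membership.Propositional using (_∈_)
open import Data.Nat using (ℕ; zero; suc)
open import Data.Product using (_×_; ∃)
open import Data.Sum using (_⊎_)
open import Function.Bundles using (_⇔_)
open import Function.Definitions using (Injective)
open import Level using (0ℓ)
open import Relation.Binary.Core using (Rel)
open import Relation.Binary.Definitions using (Symmetric; Irreflexive; Asymmetric)
open import Relation.Binary.PropositionalEquality using (_≡_; _≢_)
open import Relation.Nullary using (¬_)
open import Relation.Nullary.Decidable using (_⊎-dec_)

record Graph (n : ℕ) : Set₁ where
  field
    Adj    : Rel (Fin n) 0ℓ
    sym    : Symmetric Adj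
    irrefl : Irreflexive _≡_ Adj

-- The word x y x y ⋯ of length k.
alternating : ∀ {A : Set} → A → A → ℕ → List A
alternating x y zero    = []
alternating x y (suc k) = x ∷ alternating y x k

restrict : ∀ {n} → Fin n → Fin n → List (Fin n) → List (Fin n)
restrict x y = filter (λ z → (z ≟ x) ⊎-dec (z ≟ y))

Alternate : ∀ {n} → List (Fin n) → Fin n → Fin n → Set
Alternate w x y =
  ∃ λ k → restrict x y w ≡ alternating x y k ⊎ restrict x y w ≡ alternating y x k

Represents : ∀ {n} → List (Fin n) → Graph n → Set
Represents w G =
  (∀ x → x ∈ w) × (∀ x y → x ≢ y → Alternate w x y ⇔ Graph.Adj G x y)

WordRepresentable : ∀ {n} → Graph n → Set
WordRepresentable G = ∃ λ w → Represents w G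

record Orientation {n} (G : Graph n) : Set₁ where
  open Graph G
  field
    Arc     : Rel (Fin n) 0ℓ
    arc⇒adj : ∀ {x y} → Arc x y → Adj x y
    adj⇒arc : ∀ {x y} → Adj x y → Arc x y ⊎ Arc y x
    asym    : Asymmetric Arc

module _ {n} {G : Graph n} (O : Orientation G) where
  open Graph G
  open Orientation O

  -- Paths do not repeat vertices; k is the number of arcs.
  DirectedPath : ∀ {k} → (Fin (suc k) → Fin n) → Set
  DirectedPath {k} p =
    Injective _≡_ _≡_ p × (∀ (i : Fin k) → Arc (p (inject₁ i)) (p (suc i)))

  -- k = 0 and k = 1 need not be excluded: asymmetry of Arc rules out loops
  -- and 2-cycles.
  DirectedCycle : ∀ {k} → (Fin (suc k) → Fin n) → Set
  DirectedCycle {k} p = DirectedPath p × Arc (p (fromℕ k)) (p zero)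

  Acyclic : Set
  Acyclic = ∀ k (p : Fin (suc k) → Fin n) → ¬ DirectedCycle p

  SemiTransitive : Set
  SemiTransitive =
    Acyclic ×
    (∀ k (p : Fin (suc k) → Fin n) → DirectedPath p →
      ¬ Adj (p zero) (p (fromℕ k)) ⊎ (∀ i j → i < j → Arc (p i) (p j)))

  IsSource : Fin n → Set
  IsSource v = ∀ u → Adj v u → Arc v u

  IsSink : Fin n → Set
  IsSink v = ∀ u → Adj v u → Arc u v

{-# OPTIONS --safe #-}

-- Let w represent G. Two letters alternate in w with x first iff
-- #y ≤ #x ≤ 1 + #y on every prefix of w. Fix a prefix u of w and measure the
-- counts relative to u: the level of x at a prefix p is #x(p) − #x(u), up to a
-- constant. Such a shift may swap the roles of x and y, but x and y are still
-- adjacent iff one of them stays ahead of the other by 0 or 1. Orient edges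
-- from the leading letter to the trailing one. Levels descend along a directed
-- path, so if its ends are joined by an edge, all of its levels lie within 1 of
-- each other at every prefix, whence all its vertices are joined by forward
-- arcs. All levels agree at u, so if v is the letter of w just after u, then v
-- is strictly ahead of every other letter at u v, and v is a source. If instead
-- u = u′ v, then v is strictly behind every other letter at u′, and is a sink.
module Submission where

open import Data.Empty using (⊥-elim)
open import Data.Fin using (Fin; zero; suc; inject₁; fromℕ)
import Data.Fin as Fin
open import Data.Fin.Properties using (_≟_; ≤fromℕ)
import Data.Fin.Properties as Fin
open import Data.List using (List; []; _∷_; _++_; [_]; filter; length)
open import Data.List.Membership.Propositional.Properties using (∈-∃++)
open import Data.List.Properties
  using (≡-dec; ∷-injectiveˡ; ∷-injectiveʳ; filter-≐; ++-assoc)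
open import Data.Nat using (ℕ; zero; suc; _+_; _≤_; z≤n; s≤s)
open import Data.Nat.Properties hiding (_≟_)
open import Data.Product using (_×_; _,_; proj₁; proj₂; ∃; map₂)
open import Data.Sum using (_⊎_; inj₁; inj₂; [_,_]′; swap)
import Data.Sum as Sum
open import Defs
open import Function using (_∘_)
open import Function.Bundles using (Equivalence)
open import Relation.Binary.PropositionalEquality
  using (_≡_; _≢_; refl; sym; trans; cong; subst; ≢-sym; module ≡-Reasoning)
open import Relation.Nullary using (¬_; Dec; yes; no; contradiction)
open import Relation.Nullary.Decidable using (map′; _⊎-dec_; ¬?)

-- Descending sequences, and counts that differ by 0 or 1

antitone : ∀ {k} (f : Fin (suc k) → ℕ) → (∀ i → f (suc i) ≤ f (inject₁ i)) →
  ∀ {i j} → i Fin.≤ j → f j ≤ f i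
antitone f step {zero}  {zero}  _ = ≤-refl
antitone {suc k} f step {zero} {suc j} _ =
  ≤-trans (antitone (f ∘ suc) (step ∘ suc) {zero} {j} z≤n) (step zero)
antitone {suc k} f step {suc i} {suc j} (s≤s i≤j) =
  antitone (f ∘ suc) (step ∘ suc) i≤j

Ahead : ℕ → ℕ → Set
Ahead a b = b ≤ a × a ≤ suc b

ahead-cases : ∀ {a b} → Ahead a b → a ≡ b ⊎ a ≡ suc b
ahead-cases (b≤a , a≤1+b) with m≤n⇒m<n∨m≡n b≤a
... | inj₁ b<a = inj₂ (≤-antisym a≤1+b b<a)
... | inj₂ b≡a = inj₁ (sym b≡a)

-- The lead changes hands when the trailing count grows by one. This is used both for reading off a
-- letter and for a shift that swaps two letters.
ahead-suc : ∀ {a b} → Ahead b a → Ahead (suc a) b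
ahead-suc (a≤b , b≤1+a) = b≤1+a , s≤s a≤b

ahead-pred : ∀ {a b} → Ahead (suc a) b → Ahead b a
ahead-pred (b≤1+a , s≤s a≤b) = a≤b , b≤1+a

ahead-+ʳ : ∀ c {a b} → Ahead a b → Ahead (a + c) (b + c)
ahead-+ʳ c (b≤a , a≤1+b) = +-monoˡ-≤ c b≤a , +-monoˡ-≤ c a≤1+b

ahead-cancelʳ : ∀ c {a b} → Ahead (a + c) (b + c) → Ahead a b
ahead-cancelʳ c {a} {b} (l , u) =
  +-cancelʳ-≤ c b a l , +-cancelʳ-≤ c a (suc b) u

-- Alternation in terms of prefix counts

module _ {n : ℕ} where

  count : Fin n → List (Fin n) → ℕ
  count x p = length (filter (_≟ x) p)

  cocount : Fin n → List (Fin n) → ℕ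
  cocount x p = length (filter (λ z → ¬? (z ≟ x)) p)

  count-∷ʳ-≡ : ∀ x p → count x (p ++ [ x ]) ≡ suc (count x p)
  count-∷ʳ-≡ x [] with x ≟ x
  ... | yes _  = refl
  ... | no x≢x = contradiction refl x≢x
  count-∷ʳ-≡ x (z ∷ p) with z ≟ x
  ... | yes _ = cong suc (count-∷ʳ-≡ x p)
  ... | no  _ = count-∷ʳ-≡ x p

  count-∷ʳ-≢ : ∀ {x z} p → z ≢ x → count x (p ++ [ z ]) ≡ count x p
  count-∷ʳ-≢ {x} {z} [] z≢x with z ≟ x
  ... | yes z≡x = contradiction z≡x z≢x
  ... | no  _   = refl
  count-∷ʳ-≢ {x} (y ∷ p) z≢x with y ≟ x
  ... | yes _ = cong suc (count-∷ʳ-≢ p z≢x)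
  ... | no  _ = count-∷ʳ-≢ p z≢x

  count+cocount : ∀ x p → count x p + cocount x p ≡ length p
  count+cocount x [] = refl
  count+cocount x (z ∷ p) with z ≟ x
  ... | yes _ = cong suc (count+cocount x p)
  ... | no  _ = trans (+-suc (count x p) (cocount x p)) (cong suc (count+cocount x p))

  OnPrefixes : List (Fin n) → (List (Fin n) → Set) → Set
  OnPrefixes w P = ∀ p s → w ≡ p ++ s → P p

  Leads : List (Fin n) → Fin n → Fin n → Set
  Leads w x y = OnPrefixes w λ p → Ahead (count x p) (count y p)

  restrict-swap : ∀ (x y : Fin n) w {xs} → restrict x y w ≡ xs → restrict y x w ≡ xs
  restrict-swap x y w = trans (filter-≐ _ _ (swap , swap) w)

  -- Removing the first x turns xyxy... into yxyx..., so the induction on the word exchanges the two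
  -- letters; counting that x again gives the lead back to x.
  alternating⇒leads : ∀ {x y} → x ≢ y → ∀ k w →
    restrict x y w ≡ alternating x y k → Leads w x y
  alternating⇒leads x≢y k w eq [] s _ = z≤n , z≤n
  alternating⇒leads {x} {y} x≢y k (z ∷ w) eq (_ ∷ p) s refl with z ≟ x | z ≟ y
  alternating⇒leads x≢y k _ eq (_ ∷ p) s refl | yes refl | yes refl =
    contradiction refl x≢y
  alternating⇒leads {x} {y} x≢y (suc k) (_ ∷ w) eq (_ ∷ p) s refl | yes refl | no _ =
    ahead-suc (alternating⇒leads (≢-sym x≢y) k w
      (restrict-swap x y w (∷-injectiveʳ eq)) p s refl)
  alternating⇒leads x≢y (suc k) _ eq (_ ∷ p) s refl | no _ | yes refl =
    contradiction (sym (∷-injectiveˡ eq)) x≢y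
  alternating⇒leads x≢y k (_ ∷ w) eq (_ ∷ p) s refl | no _ | no _ =
    alternating⇒leads x≢y k w eq p s refl

  leads⇒alternating : ∀ {x y} → x ≢ y → ∀ w → Leads w x y →
    ∃ λ k → restrict x y w ≡ alternating x y k
  leads⇒alternating x≢y [] L = 0 , refl
  -- `L′` is bound before the case split on z, so that the split evaluates the counts in its type.
  leads⇒alternating {x} {y} x≢y (z ∷ w) L with L′ ← (λ p s eq → L (z ∷ p) s (cong (z ∷_) eq))
    with z ≟ x | z ≟ y
  ... | yes refl | yes refl = contradiction refl x≢y
  ... | yes refl | no _
    with k , eq ← leads⇒alternating (≢-sym x≢y) w (λ p s e → ahead-pred (L′ p s e)) =
    suc k , cong (x ∷_) (restrict-swap y x w eq)
  -- The one-letter prefix y would contain more copies of y than of x.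
  ... | no _ | yes refl = contradiction (proj₁ (L′ [] w refl)) λ ()
  ... | no _ | no _     = leads⇒alternating x≢y w L′

  alternate⇒leads : ∀ {x y} → x ≢ y → ∀ w → Alternate w x y → Leads w x y ⊎ Leads w y x
  alternate⇒leads {x} {y} x≢y w (k , eq) = Sum.map
    (alternating⇒leads x≢y k w)
    (alternating⇒leads (≢-sym x≢y) k w ∘ restrict-swap x y w) eq

  leads⇒alternate : ∀ {x y} → x ≢ y → ∀ w → Leads w x y ⊎ Leads w y x → Alternate w x y
  leads⇒alternate x≢y w (inj₁ L) = map₂ inj₁ (leads⇒alternating x≢y w L)
  leads⇒alternate {x} {y} x≢y w (inj₂ L) =
    map₂ (inj₂ ∘ restrict-swap y x w) (leads⇒alternating (≢-sym x≢y) w L)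

  length-alternating : ∀ (x y : Fin n) k → length (alternating x y k) ≡ k
  length-alternating x y zero    = refl
  length-alternating x y (suc k) = cong suc (length-alternating y x k)

  -- Only k = `length xs` is possible, so a single comparison decides the existence.
  alternating? : ∀ (x y : Fin n) xs → Dec (∃ λ k → xs ≡ alternating x y k)
  alternating? x y xs =
    map′ (length xs ,_) (λ { (k , refl) → cong (alternating x y) (sym (length-alternating x y k)) })
         (≡-dec _≟_ xs (alternating x y (length xs)))

  alternate? : ∀ w x y → Dec (Alternate w x y)
  alternate? w x y =
    map′ [ map₂ inj₁ , map₂ inj₂ ]′
         (λ { (k , inj₁ eq) → inj₁ (k , eq) ; (k , inj₂ eq) → inj₂ (k , eq) })
         (alternating? x y (restrict x y w) ⊎-dec alternating? y x (restrict x y w))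

-- The orientation obtained from a cut of the word

module ShiftedOrientation {n} (G : Graph n) (u t : List (Fin n))
  (rep : Represents (u ++ t) G) where

  open Graph G using (Adj; irrefl)

  w : List (Fin n)
  w = u ++ t

  adj⇒≢ : ∀ {x y} → Adj x y → x ≢ y
  adj⇒≢ a x≡y = irrefl x≡y a

  -- `Adj` is an arbitrary relation; the word makes it decidable, which the dichotomy in
  -- semi-transitivity calls for.
  adj? : ∀ x y → Dec (Adj x y)
  adj? x y with x ≟ y
  ... | yes x≡y = no (irrefl x≡y)
  ... | no  x≢y = map′ to from (alternate? w x y)
    where open Equivalence (proj₂ rep x y x≢y)

  -- Since cocount x u = length u − count x u, this is the count of x relative
  -- to u, raised by length u to stay within ℕ.
  level : Fin n → List (Fin n) → ℕ
  level x p = count x p + cocount x u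

  level-pivot : ∀ x → level x u ≡ length u
  level-pivot x = count+cocount x u

  level-∷ʳ-≡ : ∀ x p → level x (p ++ [ x ]) ≡ suc (level x p)
  level-∷ʳ-≡ x p = cong (_+ cocount x u) (count-∷ʳ-≡ x p)

  level-∷ʳ-≢ : ∀ {x z} p → z ≢ x → level x (p ++ [ z ]) ≡ level x p
  level-∷ʳ-≢ {x} p z≢x = cong (_+ cocount x u) (count-∷ʳ-≢ p z≢x)

  -- Every level is `Ahead` of itself, so distinctness is what excludes loops.
  _⟶_ : Fin n → Fin n → Set
  x ⟶ y = x ≢ y × OnPrefixes w λ p → Ahead (level x p) (level y p)

  leads⇒arc : ∀ {x y} → x ≢ y → Leads w x y → x ⟶ y ⊎ y ⟶ x
  leads⇒arc {x} {y} x≢y L with ahead-cases (L u t refl)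
  ... | inj₁ cx≡cy = inj₁ (x≢y , λ p s eq →
        subst (λ c → Ahead (level x p) (count y p + c)) c̄x≡c̄y
          (ahead-+ʳ (cocount x u) (L p s eq)))
    where
    c̄x≡c̄y : cocount x u ≡ cocount y u
    c̄x≡c̄y = +-cancelˡ-≡ (count x u) _ _ (begin
      count x u + cocount x u ≡⟨ level-pivot x ⟩
      length u                ≡⟨ level-pivot y ⟨
      count y u + cocount y u ≡⟨ cong (_+ cocount y u) cx≡cy ⟨
      count x u + cocount y u ∎)
      where open ≡-Reasoning
  -- Here x occurs once more in u than y does, so the shift of x is smaller by one and the roles
  -- swap.
  ... | inj₂ cx≡1+cy = inj₂ (≢-sym x≢y , λ p s eq →
        subst (λ c → Ahead c (level x p))
          (trans (sym (+-suc (count y p) (cocount x u))) (cong (count y p +_) 1+c̄x≡c̄y))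
          (ahead-suc (ahead-+ʳ (cocount x u) (L p s eq))))
    where
    1+c̄x≡c̄y : suc (cocount x u) ≡ cocount y u
    1+c̄x≡c̄y = +-cancelˡ-≡ (count y u) _ _ (begin
      count y u + suc (cocount x u) ≡⟨ +-suc (count y u) (cocount x u) ⟩
      suc (count y u) + cocount x u ≡⟨ cong (_+ cocount x u) cx≡1+cy ⟨
      count x u + cocount x u       ≡⟨ level-pivot x ⟩
      length u                      ≡⟨ level-pivot y ⟨
      count y u + cocount y u       ∎)
      where open ≡-Reasoning

  -- At the empty prefix the levels are the bare shifts, so these differ by 0 or 1, and undoing them
  -- keeps or swaps the roles.
  arc⇒leads : ∀ {x y} → x ⟶ y → Leads w x y ⊎ Leads w y x
  arc⇒leads {x} {y} (_ , A) with ahead-cases (A [] w refl)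
  ... | inj₁ c̄x≡c̄y = inj₁ λ p s eq → ahead-cancelʳ (cocount x u)
        (subst (λ c → Ahead (level x p) (count y p + c)) (sym c̄x≡c̄y) (A p s eq))
  ... | inj₂ c̄x≡1+c̄y = inj₂ λ p s eq → ahead-cancelʳ (cocount y u)
        (ahead-pred (subst (λ c → Ahead c (level y p))
          (trans (cong (count x p +_) c̄x≡1+c̄y) (+-suc (count x p) (cocount y u)))
          (A p s eq)))

  -- Passing an occurrence of x raises the level of x alone.
  levels-separate : ∀ {x y} → x ≢ y → ¬ OnPrefixes w (λ p → level x p ≡ level y p)
  levels-separate {x} {y} x≢y eqs with p , s , eq ← ∈-∃++ (proj₁ rep x) =
    1+n≢n (begin
      suc (level x p)      ≡⟨ level-∷ʳ-≡ x p ⟨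
      level x (p ++ [ x ]) ≡⟨ eqs (p ++ [ x ]) s (trans eq (sym (++-assoc p [ x ] s))) ⟩
      level y (p ++ [ x ]) ≡⟨ level-∷ʳ-≢ p x≢y ⟩
      level y p            ≡⟨ eqs p (x ∷ s) eq ⟨
      level x p            ∎)
    where open ≡-Reasoning

  orientation : Orientation G
  orientation = record
    { Arc     = _⟶_
    ; arc⇒adj = λ {x} {y} a →
        Equivalence.to (proj₂ rep x y (proj₁ a)) (leads⇒alternate (proj₁ a) w (arc⇒leads a))
    ; adj⇒arc = λ {x} {y} a → let x≢y = adj⇒≢ a in
        [ leads⇒arc x≢y , swap ∘ leads⇒arc (≢-sym x≢y) ]′
          (alternate⇒leads x≢y w (Equivalence.from (proj₂ rep x y x≢y) a))
    ; asym    = λ { (x≢y , A) (_ , B) → levels-separate x≢y λ p s eq →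
        ≤-antisym (proj₁ (B p s eq)) (proj₁ (A p s eq)) }
    }

  open Orientation orientation using (adj⇒arc)

  path-descends : ∀ {k} (q : Fin (suc k) → Fin n) → DirectedPath orientation q →
    ∀ {i j} → i Fin.≤ j → OnPrefixes w λ p → level (q j) p ≤ level (q i) p
  path-descends q (_ , arcs) i≤j p s eq =
    antitone (λ i → level (q i) p) (λ i → proj₁ (proj₂ (arcs i) p s eq)) i≤j

  acyclic : Acyclic orientation
  -- Levels descend along the path and the closing arc bounds the first by the last, so the two ends
  -- would agree at every prefix.
  acyclic k q (path , last≢first , A) = levels-separate last≢first λ p s eq →
    ≤-antisym (path-descends q path z≤n p s eq) (proj₁ (A p s eq))

  semiTransitive : SemiTransitive orientation
  semiTransitive = acyclic , shortcut-free
    where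
    shortcut-free : ∀ k (q : Fin (suc k) → Fin n) → DirectedPath orientation q →
      ¬ Adj (q zero) (q (fromℕ k)) ⊎ (∀ i j → i Fin.< j → q i ⟶ q j)
    shortcut-free k q path@(injective , _) with adj? (q zero) (q (fromℕ k))
    ... | no ¬adj = inj₁ ¬adj
    ... | yes adj with adj⇒arc adj
    -- Oriented backwards, the edge would close the path into a cycle.
    ...   | inj₂ back = ⊥-elim (acyclic k q (path , back))
    ...   | inj₁ (_ , A) = inj₂ λ i j i<j →
            (λ qi≡qj → Fin.<⇒≢ i<j (injective qi≡qj)) ,
            λ p s eq → path-descends q path (<⇒≤ i<j) p s eq , (begin
              level (q i) p               ≤⟨ path-descends q path {zero} {i} z≤n p s eq ⟩
              level (q zero) p            ≤⟨ proj₂ (A p s eq) ⟩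
              suc (level (q (fromℕ k)) p) ≤⟨ s≤s (path-descends q path (≤fromℕ j) p s eq) ⟩
              suc (level (q j) p)         ∎)
            where open ≤-Reasoning

  next-letter-isSource : ∀ {v s} → t ≡ v ∷ s → IsSource orientation v
  next-letter-isSource {v} {s} t≡v∷s x adj with adj⇒arc adj
  ... | inj₁ v⟶x = v⟶x
  ... | inj₂ (x≢v , A) = contradiction
        (begin-strict
          length u             ≡⟨ level-pivot v ⟨
          level v u            <⟨ n<1+n (level v u) ⟩
          suc (level v u)      ≡⟨ level-∷ʳ-≡ v u ⟨
          level v (u ++ [ v ]) ≤⟨ proj₁ (A (u ++ [ v ]) s
                                    (trans (cong (u ++_) t≡v∷s) (sym (++-assoc u [ v ] s)))) ⟩
          level x (u ++ [ v ]) ≡⟨ level-∷ʳ-≢ u (≢-sym x≢v) ⟩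
          level x u            ≡⟨ level-pivot x ⟩
          length u             ∎)
        (<-irrefl refl)
    where open ≤-Reasoning

  last-letter-isSink : ∀ {u′ v} → u ≡ u′ ++ [ v ] → IsSink orientation v
  last-letter-isSink {u′} {v} u≡u′v x adj with adj⇒arc adj
  ... | inj₂ x⟶v = x⟶v
  ... | inj₁ (v≢x , A) = contradiction
        (begin-strict
          level v u′            <⟨ n<1+n (level v u′) ⟩
          suc (level v u′)      ≡⟨ level-∷ʳ-≡ v u′ ⟨
          level v (u′ ++ [ v ]) ≡⟨ cong (level v) u≡u′v ⟨
          level v u             ≡⟨ level-pivot v ⟩
          length u              ≡⟨ level-pivot x ⟨
          level x u             ≡⟨ cong (level x) u≡u′v ⟩
          level x (u′ ++ [ v ]) ≡⟨ level-∷ʳ-≢ u′ v≢x ⟩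
          level x u′            ≤⟨ proj₁ (A u′ (v ∷ t)
                                     (trans (cong (_++ t) u≡u′v) (++-assoc u′ [ v ] t))) ⟩
          level v u′            ∎)
        (<-irrefl refl)
    where open ≤-Reasoning

-- Choice of the cut

semiTransitive-source : ∀ {n} (G : Graph n) → WordRepresentable G → ∀ v →
  ∃ λ (O : Orientation G) → SemiTransitive O × IsSource O v
semiTransitive-source G (w , rep) v with u , s , refl ← ∈-∃++ (proj₁ rep v) =
  orientation , semiTransitive , next-letter-isSource refl
  where open ShiftedOrientation G u (v ∷ s) rep

semiTransitive-sink : ∀ {n} (G : Graph n) → WordRepresentable G → ∀ v →
  ∃ λ (O : Orientation G) → SemiTransitive O × IsSink O v
semiTransitive-sink G (w , rep) v with u , s , refl ← ∈-∃++ (proj₁ rep v) =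
  orientation , semiTransitive , last-letter-isSink refl
  where
  -- The cut is moved past the chosen occurrence of v, so the representation is transported along
  -- reassociation.
  open ShiftedOrientation G (u ++ [ v ]) s
    (subst (λ w → Represents w G) (sym (++-assoc u [ v ] s)) rep)

theorem6 : ∀ (n : ℕ) (G : Graph n) → WordRepresentable G → (v : Fin n) →
    (∃ λ (O : Orientation G) → SemiTransitive O × IsSource O v) ×
    (∃ λ (O : Orientation G) → SemiTransitive O × IsSink O v)
theorem6 n G wr v = semiTransitive-source G wr v , semiTransitive-sink G wr v
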